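{- For every $n \in \mathbb{N}$, there is a (finite, simple, undirected) graph $G$ with $\chi(G) \geq n$ and $\omega(G) \leq 3$ such that every induced subgraph $H$ of $G$ with $\omega(H) \leq 2$ satisfies $\chi(H) \leq 4$.
   Context: $\chi$ denotes chromatic number and $\omega$ denotes clique number. -}

module Defs where

open import Data.Nat.Base using (ℕ; zero; suc; _≤_; z≤n; s≤s; _^_)
open import Data.Nat.Properties as ℕ using (_≟_; ≤∧≢⇒<)
open import Data.Fin.Base using (Fin; zero; suc; finToFun; funToFin)
open import Data.Fin.Properties as Fin using (any?; all?; finToFun-funToFin; suc-injective)
open import Data.Fin.Subset using (Subset; inside; outside; _∈_; ∣_∣; ⊥)
open import Data.Fin.Subset.Properties using (_∈?_; ∣p∣≤n; anySubset?; ∉⊥; ∣⊥∣≡0)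
open import Data.Product.Base using (∃-syntax; _×_; _,_; proj₁)
open import Data.Vec.Base using (_∷_; here; there)
open import Function.Base using (id; _∘_; _on_)
open import Function.Definitions using (Injective)
open import Level using (0ℓ)
open import Relation.Binary.Core using (Rel)
open import Relation.Binary.Definitions using (Symmetric; Irreflexive; Decidable)
open import Relation.Binary.PropositionalEquality using (_≡_; _≢_; refl; cong; subst; subst₂)
open import Relation.Nullary using (Dec; yes; no; ¬?; contradiction; map′; _×-dec_; _→-dec_)
open import Relation.Unary as U using (Pred)

IsLeast : Pred ℕ 0ℓ → ℕ → Set
IsLeast P m = P m × (∀ k → P k → m ≤ k)

IsGreatest : Pred ℕ 0ℓ → ℕ → Set
IsGreatest P m = P m × (∀ k → P k → k ≤ m)

least : ∀ {P : Pred ℕ 0ℓ} → U.Decidable P → ∀ b → P b → ∃[ m ] IsLeast P m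
least P? zero    p = zero , p , λ _ _ → z≤n
least P? (suc b) p with P? zero
... | yes p₀ = zero , p₀ , λ _ _ → z≤n
... | no ¬p₀ with least (P? ∘ suc) b p
...   | m , pm , min = suc m , pm , λ where
        zero    q → contradiction q ¬p₀
        (suc k) q → s≤s (min k q)

greatest : ∀ {P : Pred ℕ 0ℓ} → U.Decidable P → P 0 →
           ∀ b → (∀ k → P k → k ≤ b) → ∃[ m ] IsGreatest P m
greatest P? p₀ zero    bd = zero , p₀ , bd
greatest {P} P? p₀ (suc b) bd with P? (suc b)
... | yes p = suc b , p , bd
... | no ¬p = greatest P? p₀ b λ k q →
        ℕ.≤-pred (≤∧≢⇒< (bd k q) λ k≡1+b → ¬p (subst P k≡1+b q))

-- Finite, simple, undirected graphs, with vertex set Fin order.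
record Graph : Set₁ where
  field
    order      : ℕ
    Adj        : Rel (Fin order) 0ℓ
    Adj?       : Decidable Adj
    Adj-sym    : Symmetric Adj
    Adj-irrefl : Irreflexive _≡_ Adj

open Graph public

IsProper : (G : Graph) → ∀ {k} → (Fin (order G) → Fin k) → Set
IsProper G c = ∀ x y → Adj G x y → c x ≢ c y

Colourable : Graph → ℕ → Set
Colourable G k = ∃[ c ] IsProper G {k} c

isProper? : ∀ G {k} (c : Fin (order G) → Fin k) → Dec (IsProper G c)
isProper? G c = all? λ x → all? λ y → Adj? G x y →-dec ¬? (c x Fin.≟ c y)

colourable? : ∀ G → U.Decidable (Colourable G)
colourable? G k = map′
  (λ (i , p) → finToFun i , p)
  (λ (c , p) → funToFin c , λ x y a e → p x y a
    (subst₂ _≡_ (finToFun-funToFin c x) (finToFun-funToFin c y) e))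
  (any? {k ^ order G} λ i → isProper? G (finToFun i))

chromatic : ∀ G → ∃[ k ] IsLeast (Colourable G) k
chromatic G = least (colourable? G) (order G)
  (id , λ x y a x≡y → Adj-irrefl G x≡y a)

χ : Graph → ℕ
χ G = proj₁ (chromatic G)

IsClique : (G : Graph) → Subset (order G) → Set
IsClique G S = ∀ x y → x ∈ S → y ∈ S → x ≢ y → Adj G x y

HasClique : Graph → ℕ → Set
HasClique G k = ∃[ S ] (IsClique G S × ∣ S ∣ ≡ k)

isClique? : ∀ G → U.Decidable (IsClique G)
isClique? G S = all? λ x → all? λ y →
  (x ∈? S) →-dec ((y ∈? S) →-dec (¬? (x Fin.≟ y) →-dec Adj? G x y))

hasClique? : ∀ G → U.Decidable (HasClique G)
hasClique? G k = anySubset? λ S → isClique? G S ×-dec (∣ S ∣ ≟ k)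

clique : ∀ G → ∃[ k ] IsGreatest (HasClique G) k
clique G = greatest (hasClique? G)
  (⊥ , (λ x y x∈⊥ → contradiction x∈⊥ ∉⊥) , ∣⊥∣≡0 (order G))
  (order G) λ where _ (S , _ , refl) → ∣p∣≤n S

ω : Graph → ℕ
ω G = proj₁ (clique G)

-- The increasing enumeration of the elements of a subset.
enum : ∀ {n} (S : Subset n) → Fin ∣ S ∣ → Fin n
enum (inside  ∷ S) zero    = zero
enum (inside  ∷ S) (suc i) = suc (enum S i)
enum (outside ∷ S) i       = suc (enum S i)

enum-injective : ∀ {n} (S : Subset n) → Injective _≡_ _≡_ (enum S)
enum-injective (inside  ∷ S) {zero}  {zero}  _ = refl
enum-injective (inside  ∷ S) {suc i} {suc j} e = cong suc (enum-injective S (suc-injective e))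
enum-injective (outside ∷ S)                 e = enum-injective S (suc-injective e)

enum-∈ : ∀ {n} (S : Subset n) i → enum S i ∈ S
enum-∈ (inside  ∷ S) zero    = here
enum-∈ (inside  ∷ S) (suc i) = there (enum-∈ S i)
enum-∈ (outside ∷ S) i       = there (enum-∈ S i)

enum-surjective : ∀ {n} (S : Subset n) {x} → x ∈ S → ∃[ i ] enum S i ≡ x
enum-surjective (inside  ∷ S) here      = zero , refl
enum-surjective (inside  ∷ S) (there p) with enum-surjective S p
... | i , e = suc i , cong suc e
enum-surjective (outside ∷ S) (there p) with enum-surjective S p
... | i , e = i , cong suc e

-- The subgraph of G induced by S, its vertices renumbered along enum S so
-- that they again form some Fin n.
_[_] : (G : Graph) → Subset (order G) → Graph
G [ S ] = record
  { order      = ∣ S ∣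
  ; Adj        = Adj G on enum S
  ; Adj?       = λ x y → Adj? G (enum S x) (enum S y)
  ; Adj-sym    = Adj-sym G
  ; Adj-irrefl = λ x≡y → Adj-irrefl G (cong (enum S) x≡y)
  }

{-# OPTIONS --safe #-}

-- Zykov's construction, with every new vertex oriented towards the old ones,
-- gives acyclic digraphs of arbitrarily large chromatic number in which there
-- is at most one directed path between any two vertices.  Join u and v
-- whenever there is a directed path between them whose length is not
-- divisible by 3.  Path lengths add up, so on a clique the signed length mod 3
-- of the path from a fixed vertex is injective, and cliques have at most three
-- vertices.  If u → v → w are paths of the same nonzero residue mod 3, then
-- u, v, w is a triangle; so in a triangle-free induced subgraph the edges of
-- either residue form a bipartite graph (vertices with an out-edge against
-- those without), and the product of the two bipartitions is a proper
-- 4-colouring.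
module Submission where

open import Defs
open import Data.Bool.Base using (if_then_else_)
open import Data.Nat.Base as ℕ using (ℕ; zero; suc; _≤_; _≥_; z≤n; _^_)
open import Data.Nat.DivMod using (_mod_)
open import Data.Nat.Properties as ℕ using (≤-trans; ≮⇒≥; ≰⇒>)
open import Data.Fin.Base using (Fin; zero; suc; toℕ; opposite; punchOut; inject≤; splitAt; join; combine; remQuot; finToFun; funToFin)
open import Data.Fin.Properties as Fin using (_≟_; any?; all?; pigeonhole; punchOut-injective; inject≤-injective; splitAt-join; remQuot-combine; finToFun-funToFin)
open import Data.Fin.Subset using (Subset; _∈_; _∪_; _-_; ⁅_⁆; ∣_∣)
open import Data.Fin.Subset.Properties using (x∈⁅x⁆; x∈⁅y⁆⇒x≡y; x∈p∪q⁻; x∈p∪q⁺; x∈p∧x≢y⇒x∈p-y; x∈p⇒∣p-x∣<∣p∣)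
open import Data.Product.Base using (_×_; ∃-syntax; _,_; proj₁; proj₂; map₂)
open import Data.Sum.Base as Sum using (_⊎_; inj₁; inj₂)
open import Data.Empty using (⊥)
open import Function.Base using (_∘_; id)
open import Relation.Binary.PropositionalEquality using (_≡_; _≢_; refl; sym; trans; cong; subst; subst₂; module ≡-Reasoning)
open import Relation.Nullary using (¬_; Dec; yes; no; does; contradiction; _×-dec_; _⊎-dec_; _→-dec_)
open import Relation.Nullary.Decidable using (from-yes; dec-true; dec-false; decidable-stable; ¬?)

-- Arithmetic modulo 3.

infixl 6 _⊕_
infix 8 ⊖_

_⊕_ : Fin 3 → Fin 3 → Fin 3
a ⊕ b = (toℕ a ℕ.+ toℕ b) mod 3

⊖_ : Fin 3 → Fin 3
⊖ a = (3 ℕ.∸ toℕ a) mod 3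

⊕-assoc : ∀ a b c → (a ⊕ b) ⊕ c ≡ a ⊕ (b ⊕ c)
⊕-assoc = from-yes (all? λ a → all? λ b → all? λ c → (a ⊕ b) ⊕ c ≟ a ⊕ (b ⊕ c))

⊕-identityˡ : ∀ a → zero ⊕ a ≡ a
⊕-identityˡ = from-yes (all? λ a → zero ⊕ a ≟ a)

⊖-involutive : ∀ a → ⊖ ⊖ a ≡ a
⊖-involutive = from-yes (all? λ a → ⊖ ⊖ a ≟ a)

a≡a⊕b⇒b≡0 : ∀ a b → a ≡ a ⊕ b → b ≡ zero
a≡a⊕b⇒b≡0 = from-yes (all? λ a → all? λ b → (a ≟ a ⊕ b) →-dec (b ≟ zero))

-- This law and the six after it serve the cases of `SignedPath-⊕` other than the all-forward one,
-- each solving for `c` the equation that `Path-unique` yields there.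
a⊕b⊖c≡0⇒c≡a⊕b : ∀ a b c → a ⊕ b ⊕ ⊖ c ≡ zero → c ≡ a ⊕ b
a⊕b⊖c≡0⇒c≡a⊕b = from-yes (all? λ a → all? λ b → all? λ c →
  (a ⊕ b ⊕ ⊖ c ≟ zero) →-dec (c ≟ a ⊕ b))

c⊖b⊖a≡0⇒c≡a⊕b : ∀ a b c → c ⊕ ⊖ b ⊕ ⊖ a ≡ zero → c ≡ a ⊕ b
c⊖b⊖a≡0⇒c≡a⊕b = from-yes (all? λ a → all? λ b → all? λ c →
  (c ⊕ ⊖ b ⊕ ⊖ a ≟ zero) →-dec (c ≟ a ⊕ b))

c⊖b≡a⇒c≡a⊕b : ∀ a b c → c ⊕ ⊖ b ≡ a → c ≡ a ⊕ b
c⊖b≡a⇒c≡a⊕b = from-yes (all? λ a → all? λ b → all? λ c →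
  (c ⊕ ⊖ b ≟ a) →-dec (c ≟ a ⊕ b))

⊖a⊕c≡b⇒c≡a⊕b : ∀ a b c → ⊖ a ⊕ c ≡ b → c ≡ a ⊕ b
⊖a⊕c≡b⇒c≡a⊕b = from-yes (all? λ a → all? λ b → all? λ c →
  (⊖ a ⊕ c ≟ b) →-dec (c ≟ a ⊕ b))

⊖c⊕a≡⊖b⇒c≡a⊕b : ∀ a b c → ⊖ c ⊕ a ≡ ⊖ b → c ≡ a ⊕ b
⊖c⊕a≡⊖b⇒c≡a⊕b = from-yes (all? λ a → all? λ b → all? λ c →
  (⊖ c ⊕ a ≟ ⊖ b) →-dec (c ≟ a ⊕ b))

b⊖c≡⊖a⇒c≡a⊕b : ∀ a b c → b ⊕ ⊖ c ≡ ⊖ a → c ≡ a ⊕ b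
b⊖c≡⊖a⇒c≡a⊕b = from-yes (all? λ a → all? λ b → all? λ c →
  (b ⊕ ⊖ c ≟ ⊖ a) →-dec (c ≟ a ⊕ b))

⊖b⊖a≡⊖c⇒c≡a⊕b : ∀ a b c → ⊖ b ⊕ ⊖ a ≡ ⊖ c → c ≡ a ⊕ b
⊖b⊖a≡⊖c⇒c≡a⊕b = from-yes (all? λ a → all? λ b → all? λ c →
  (⊖ b ⊕ ⊖ a ≟ ⊖ c) →-dec (c ≟ a ⊕ b))

suc-⊕-suc : ∀ (b : Fin 2) → suc b ⊕ suc b ≡ suc (opposite b)
suc-⊕-suc = from-yes (all? λ b → suc b ⊕ suc b ≟ suc (opposite b))

-- Path systems, their edges and cliques.

-- Path u v a says that there is a directed path from u to v, all such paths
-- having length ≡ a (mod 3).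
record PathSystem (V : Set) : Set₁ where
  field
    Path        : V → V → Fin 3 → Set
    Path?       : ∀ u v a → Dec (Path u v a)
    Path-refl   : ∀ {u} → Path u u zero
    Path-trans  : ∀ {u v w a b} → Path u v a → Path v w b → Path u w (a ⊕ b)
    Path-unique : ∀ {u v a b} → Path u v a → Path u v b → a ≡ b

  -- Writing the residue as `suc b` with `b : Fin 2` builds in that it is nonzero.
  Edge : V → V → Set
  Edge u v = ∃[ b ] (Path u v (suc b) ⊎ Path v u (suc b))

  Edge? : ∀ u v → Dec (Edge u v)
  Edge? u v = any? λ b → Path? u v (suc b) ⊎-dec Path? v u (suc b)

  Edge-sym : ∀ {u v} → Edge u v → Edge v u
  Edge-sym = map₂ Sum.swap

  Edge-irrefl : ∀ {u v} → u ≡ v → ¬ Edge u v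
  Edge-irrefl refl (b , inj₁ p) with () ← Path-unique p Path-refl
  Edge-irrefl refl (b , inj₂ p) with () ← Path-unique p Path-refl

  TriangleFree : Set
  TriangleFree = ∀ x y z → Edge x y → Edge y z → Edge x z → ⊥

  SignedPath : V → V → Fin 3 → Set
  SignedPath u v a = Path u v a ⊎ Path v u (⊖ a)

  -- In six of the eight orientations two of the paths compose to one parallel to the third. In the
  -- two cyclic ones all three form a closed path, whose residue is zero by comparison with
  -- `Path-refl`.
  SignedPath-⊕ : ∀ {u v w} a b c →
    SignedPath u v a → SignedPath v w b → SignedPath u w c → c ≡ a ⊕ b
  SignedPath-⊕ a b c (inj₁ p) (inj₁ q) (inj₁ r) = Path-unique r (Path-trans p q)
  SignedPath-⊕ a b c (inj₁ p) (inj₁ q) (inj₂ r) =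
    a⊕b⊖c≡0⇒c≡a⊕b a b c (Path-unique (Path-trans (Path-trans p q) r) Path-refl)
  SignedPath-⊕ a b c (inj₁ p) (inj₂ q) (inj₁ r) =
    c⊖b≡a⇒c≡a⊕b a b c (Path-unique (Path-trans r q) p)
  SignedPath-⊕ a b c (inj₁ p) (inj₂ q) (inj₂ r) =
    ⊖c⊕a≡⊖b⇒c≡a⊕b a b c (Path-unique (Path-trans r p) q)
  SignedPath-⊕ a b c (inj₂ p) (inj₁ q) (inj₁ r) =
    ⊖a⊕c≡b⇒c≡a⊕b a b c (Path-unique (Path-trans p r) q)
  SignedPath-⊕ a b c (inj₂ p) (inj₁ q) (inj₂ r) =
    b⊖c≡⊖a⇒c≡a⊕b a b c (Path-unique (Path-trans q r) p)
  SignedPath-⊕ a b c (inj₂ p) (inj₂ q) (inj₁ r) =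
    c⊖b⊖a≡0⇒c≡a⊕b a b c (Path-unique (Path-trans (Path-trans r q) p) Path-refl)
  SignedPath-⊕ a b c (inj₂ p) (inj₂ q) (inj₂ r) =
    ⊖b⊖a≡⊖c⇒c≡a⊕b a b c (Path-unique (Path-trans q p) r)

  Edge⇒SignedPath : ∀ {u v} → Edge u v → ∃[ a ] (a ≢ zero × SignedPath u v a)
  Edge⇒SignedPath (b , inj₁ p) = suc b , (λ ()) , inj₁ p
  Edge⇒SignedPath {u} {v} (b , inj₂ p) = ⊖ suc b , ⊖suc≢0 b ,
    inj₂ (subst (Path v u) (sym (⊖-involutive (suc b))) p)
    where
    ⊖suc≢0 : ∀ b → ⊖ suc b ≢ zero
    ⊖suc≢0 = from-yes (all? λ b → ¬? (⊖ suc b ≟ zero))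

  clique-size≤3 : ∀ {k} (f : Fin k → V) → (∀ i j → i ≢ j → Edge (f i) (f j)) → k ≤ 3
  clique-size≤3 {zero}  f edge = z≤n
  -- Among four or more vertices two share a residue as seen from `f zero`; additivity then forces
  -- the edge between them to have residue zero.
  clique-size≤3 {suc k} f edge = ≮⇒≥ λ 3<k →
    let i , j , i<j , eq = pigeonhole 3<k (proj₁ ∘ fromBase)
        c , c≢0 , d = Edge⇒SignedPath (edge i j (Fin.<⇒≢ i<j))
    in c≢0 (a≡a⊕b⇒b≡0 _ c
         (trans eq (SignedPath-⊕ _ c _ (proj₂ (fromBase i)) d (proj₂ (fromBase j)))))
    where
    fromBase : ∀ i → ∃[ a ] SignedPath (f zero) (f i) a
    fromBase i with zero ≟ i
    ... | yes refl = zero , inj₁ Path-refl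
    ... | no  0≢i  = map₂ proj₂ (Edge⇒SignedPath (edge zero i 0≢i))

  path-twice⇒triangle : ∀ {u v w} b → Path u v (suc b) → Path v w (suc b) →
    Edge u v × Edge v w × Edge u w
  path-twice⇒triangle {u} {v} {w} b p q = (b , inj₁ p) , (b , inj₁ q) ,
    (opposite b , inj₁ (subst (Path u w) (suc-⊕-suc b) (Path-trans p q)))

open PathSystem

-- Used for restriction to a vertex subset: the recorded paths may still run through deleted
-- vertices, so every law survives.
pullback : ∀ {V W} → (W → V) → PathSystem V → PathSystem W
pullback f D = record
  { Path        = λ u v → Path D (f u) (f v)
  ; Path?       = λ u v → Path? D (f u) (f v)
  ; Path-refl   = Path-refl D
  ; Path-trans  = Path-trans D
  ; Path-unique = Path-unique D
  }

-- Colouring by outgoing residues.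

module _ {n} (D : PathSystem (Fin n)) where

  HasOut : Fin n → Fin 2 → Set
  HasOut x b = ∃[ y ] Path D x y (suc b)

  hasOut? : ∀ x b → Dec (HasOut x b)
  hasOut? x b = any? λ y → Path? D x y (suc b)

  outBit : Fin n → Fin 2 → Fin 2
  outBit x b = if does (hasOut? x b) then suc zero else zero

  -- The two bits, one per nonzero residue, are packed into one of `2 ^ 2` colours.
  outColour : Fin n → Fin 4
  outColour = funToFin ∘ outBit

  outColour-≡ : ∀ {x y} → outColour x ≡ outColour y → ∀ b → HasOut x b → HasOut y b
  outColour-≡ {x} {y} eq b h = decidable-stable (hasOut? y b) λ ¬h →
    Fin.0≢1+n (begin
      zero                                ≡⟨ cong (if_then suc zero else zero) (dec-false (hasOut? y b) ¬h) ⟨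
      outBit y b                          ≡⟨ finToFun-funToFin (outBit y) b ⟨
      finToFun {2} {2} (outColour y) b    ≡⟨ cong (λ c → finToFun {2} {2} c b) eq ⟨
      finToFun {2} {2} (outColour x) b    ≡⟨ finToFun-funToFin (outBit x) b ⟩
      outBit x b                          ≡⟨ cong (if_then suc zero else zero) (dec-true (hasOut? x b) h) ⟩
      suc zero                            ∎)
    where
    open ≡-Reasoning

  outColour-path : TriangleFree D → ∀ {x y} b → Path D x y (suc b) → outColour x ≢ outColour y
  outColour-path tf {x} {y} b p eq =
    -- Sharing the colour of `x`, the vertex `y` also has an outgoing path of residue `suc b`.
    let z , q = outColour-≡ eq b (y , p)
        xy , yz , xz = path-twice⇒triangle D b p q
    in tf x y z xy yz xz

  outColour-proper : TriangleFree D → ∀ x y → Edge D x y → outColour x ≢ outColour y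
  outColour-proper tf x y (b , inj₁ p) = outColour-path tf b p
  outColour-proper tf x y (b , inj₂ p) = outColour-path tf b p ∘ sym

-- Bounds on clique and chromatic numbers.

graph : ∀ {n} → PathSystem (Fin n) → Graph
graph {n} D = record
  { order      = n
  ; Adj        = Edge D
  ; Adj?       = Edge? D
  ; Adj-sym    = Edge-sym D
  ; Adj-irrefl = Edge-irrefl D
  }

χ≤ : ∀ G {k} → Colourable G k → χ G ≤ k
χ≤ G = proj₂ (proj₂ (chromatic G)) _

ω≥ : ∀ G {k} → HasClique G k → k ≤ ω G
ω≥ G = proj₂ (proj₂ (clique G)) _

ω≤2⇒triangle-free : ∀ G → ω G ≤ 2 → ∀ x y z → Adj G x y → Adj G y z → Adj G x z → ⊥
ω≤2⇒triangle-free G ω≤2 x y z xy yz xz =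
  ℕ.<⇒≱ 2<∣T∣ (≤-trans (ω≥ G (T , T-clique , refl)) ω≤2)
  where
  T : Subset (order G)
  T = ⁅ x ⁆ ∪ (⁅ y ⁆ ∪ ⁅ z ⁆)

  ∈T⁻ : ∀ {v} → v ∈ T → v ≡ x ⊎ v ≡ y ⊎ v ≡ z
  ∈T⁻ = Sum.map (x∈⁅y⁆⇒x≡y x) (Sum.map (x∈⁅y⁆⇒x≡y y) (x∈⁅y⁆⇒x≡y z) ∘ x∈p∪q⁻ _ _) ∘ x∈p∪q⁻ _ _

  T-clique : IsClique G T
  T-clique u v u∈ v∈ u≢v with ∈T⁻ u∈ | ∈T⁻ v∈
  ... | inj₁ refl        | inj₁ refl        = contradiction refl u≢v
  ... | inj₁ refl        | inj₂ (inj₁ refl) = xy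
  ... | inj₁ refl        | inj₂ (inj₂ refl) = xz
  ... | inj₂ (inj₁ refl) | inj₁ refl        = Adj-sym G xy
  ... | inj₂ (inj₁ refl) | inj₂ (inj₁ refl) = contradiction refl u≢v
  ... | inj₂ (inj₁ refl) | inj₂ (inj₂ refl) = yz
  ... | inj₂ (inj₂ refl) | inj₁ refl        = Adj-sym G xz
  ... | inj₂ (inj₂ refl) | inj₂ (inj₁ refl) = Adj-sym G yz
  ... | inj₂ (inj₂ refl) | inj₂ (inj₂ refl) = contradiction refl u≢v

  adj⇒≢ : ∀ {u v} → Adj G u v → v ≢ u
  adj⇒≢ uv v≡u = Adj-irrefl G (sym v≡u) uv

  x∈T : x ∈ T
  x∈T = x∈p∪q⁺ (inj₁ (x∈⁅x⁆ x))

  y∈T-x : y ∈ T - x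
  y∈T-x = x∈p∧x≢y⇒x∈p-y (x∈p∪q⁺ (inj₂ (x∈p∪q⁺ (inj₁ (x∈⁅x⁆ y))))) (adj⇒≢ xy)

  z∈T-x-y : z ∈ T - x - y
  z∈T-x-y = x∈p∧x≢y⇒x∈p-y
    (x∈p∧x≢y⇒x∈p-y (x∈p∪q⁺ (inj₂ (x∈p∪q⁺ (inj₂ (x∈⁅x⁆ z))))) (adj⇒≢ xz)) (adj⇒≢ yz)

  2<∣T∣ : 2 ℕ.< ∣ T ∣
  -- Deleting `x`, `y`, `z` in turn lowers the size each time, as irreflexivity makes them distinct.
  2<∣T∣ = ≤-trans (ℕ.s≤s (≤-trans (ℕ.s≤s (≤-trans (ℕ.s≤s z≤n)
    (x∈p⇒∣p-x∣<∣p∣ z∈T-x-y))) (x∈p⇒∣p-x∣<∣p∣ y∈T-x))) (x∈p⇒∣p-x∣<∣p∣ x∈T)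

ω-graph≤3 : ∀ {n} (D : PathSystem (Fin n)) → ω (graph D) ≤ 3
ω-graph≤3 D with clique (graph D)
... | _ , (S , S-clique , refl) , _ = clique-size≤3 D (enum S) λ i j i≢j →
  S-clique _ _ (enum-∈ S i) (enum-∈ S j) (i≢j ∘ enum-injective S)

χ-triangleFree≤4 : ∀ {n} (D : PathSystem (Fin n)) (S : Subset n) →
  ω (graph D [ S ]) ≤ 2 → χ (graph D [ S ]) ≤ 4
-- Adjacency in `graph D [ S ]` is by definition `Edge D∣S`.
χ-triangleFree≤4 D S ω≤2 = χ≤ (graph D [ S ])
  (outColour D∣S , outColour-proper D∣S (ω≤2⇒triangle-free (graph D [ S ]) ω≤2))
  where
  D∣S : PathSystem (Fin ∣ S ∣)
  D∣S = pullback (enum S) D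

-- Raising the chromatic number.

-- Zykov's construction: k disjoint copies of D and, for every choice f of one
-- vertex in each copy (encoded as an element of Fin (m ^ k)), a new source with
-- an arc to every chosen vertex.
module _ {m} (k : ℕ) (D : PathSystem (Fin m)) where

  private
    Vertex : Set
    Vertex = (Fin k × Fin m) ⊎ Fin (m ^ k)

    pattern copy i u = inj₁ (i , u)
    pattern apex f   = inj₂ f

    -- An apex enters each copy by a single arc and copies are mutually unreachable, so a path from
    -- an apex into a copy is that arc followed by a path of `D`; uniqueness is thus inherited.
    ZPath : Vertex → Vertex → Fin 3 → Set
    ZPath (copy i u) (copy j v) a = i ≡ j × Path D u v a
    ZPath (copy i u) (apex g)   a = ⊥
    ZPath (apex f)   (copy j v) a = ∃[ b ] (a ≡ suc zero ⊕ b × Path D (finToFun f j) v b)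
    ZPath (apex f)   (apex g)   a = f ≡ g × a ≡ zero

    ZPath? : ∀ x y a → Dec (ZPath x y a)
    ZPath? (copy i u) (copy j v) a = (i ≟ j) ×-dec Path? D u v a
    ZPath? (copy i u) (apex g)   a = no id
    ZPath? (apex f)   (copy j v) a = any? λ b →
      (a ≟ suc zero ⊕ b) ×-dec Path? D (finToFun f j) v b
    ZPath? (apex f)   (apex g)   a = (f ≟ g) ×-dec (a ≟ zero)

    ZPath-refl : ∀ x → ZPath x x zero
    ZPath-refl (copy i u) = refl , Path-refl D
    ZPath-refl (apex f)   = refl , refl

    ZPath-trans : ∀ x y z {a b} → ZPath x y a → ZPath y z b → ZPath x z (a ⊕ b)
    ZPath-trans (copy i u) (copy j v) (copy l w) (refl , p) (refl , q) =
      refl , Path-trans D p q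
    ZPath-trans (apex f) (copy j v) (copy l w) {b = b} (c , refl , p) (refl , q) =
      c ⊕ b , ⊕-assoc (suc zero) c b , Path-trans D p q
    ZPath-trans (apex f) (apex g) (copy l w) (refl , refl) (c , refl , p) =
      c , ⊕-identityˡ _ , p
    ZPath-trans (apex f) (apex g) (apex h) (refl , refl) (refl , refl) = refl , refl

    ZPath-unique : ∀ x y {a b} → ZPath x y a → ZPath x y b → a ≡ b
    ZPath-unique (copy i u) (copy j v) (_ , p) (_ , q) = Path-unique D p q
    ZPath-unique (apex f) (copy j v) (_ , refl , p) (_ , refl , q) =
      cong (suc zero ⊕_) (Path-unique D p q)
    ZPath-unique (apex f) (apex g) (_ , refl) (_ , refl) = refl

    zykovSum : PathSystem Vertex
    zykovSum = record
      { Path        = ZPath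
      ; Path?       = ZPath?
      ; Path-refl   = λ {x} → ZPath-refl x
      ; Path-trans  = λ {x} {y} {z} → ZPath-trans x y z
      ; Path-unique = λ {x} {y} → ZPath-unique x y
      }

    decode : Fin (k ℕ.* m ℕ.+ m ^ k) → Vertex
    decode = Sum.map₁ (remQuot m) ∘ splitAt (k ℕ.* m)

    encode : Vertex → Fin (k ℕ.* m ℕ.+ m ^ k)
    encode (copy i u) = join (k ℕ.* m) (m ^ k) (inj₁ (combine i u))
    encode (apex f)   = join (k ℕ.* m) (m ^ k) (inj₂ f)

    decode-encode : ∀ x → decode (encode x) ≡ x
    decode-encode (copy i u) = trans
      (cong (Sum.map₁ (remQuot m)) (splitAt-join (k ℕ.* m) (m ^ k) (inj₁ (combine i u))))
      (cong inj₁ (remQuot-combine i u))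
    decode-encode (apex f) =
      cong (Sum.map₁ (remQuot m)) (splitAt-join (k ℕ.* m) (m ^ k) (inj₂ f))

  zykov : PathSystem (Fin (k ℕ.* m ℕ.+ m ^ k))
  zykov = pullback decode zykovSum

  private
    encode-edge : ∀ x y → Edge zykovSum x y → Edge zykov (encode x) (encode y)
    encode-edge x y = subst₂ (Edge zykovSum) (sym (decode-encode x)) (sym (decode-encode y))

    copy-edge : ∀ i u v → Edge D u v → Edge zykovSum (copy i u) (copy i v)
    copy-edge i u v = map₂ (Sum.map (refl ,_) (refl ,_))

    apex-edge : ∀ f i → Edge zykovSum (apex (funToFin f)) (copy i (f i))
    -- One arc followed by the trivial path at the chosen vertex: residue 1.
    apex-edge f i = zero , inj₁ (zero , refl ,
      subst (λ u → Path D u (f i) zero) (sym (finToFun-funToFin f i)) (Path-refl D))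

  -- In a k-colouring every copy uses every colour, so some apex sees a vertex
  -- of colour i in the i-th copy for all i.
  zykov-uncolourable : ∀ {l} → k ≡ suc l →
    ¬ Colourable (graph D) l → ¬ Colourable (graph zykov) k
  zykov-uncolourable {l} refl ¬col (c , proper) =
    proper _ _ (encode-edge (apex (funToFin choice)) (copy i (choice i)) (apex-edge choice i))
      (sym (proj₂ (hit i)))
    where
    hit : ∀ i → ∃[ u ] c (encode (copy i u)) ≡ i
    -- If copy `i` missed colour `i`, deleting that colour with `punchOut` would leave an
    -- `l`-colouring of `D`.
    hit i = decidable-stable (any? λ u → c (encode (copy i u)) ≟ i) λ miss →
      let i≢c : ∀ u → i ≢ c (encode (copy i u))
          i≢c u e = miss (u , sym e)
      in ¬col ((λ u → punchOut (i≢c u)) , λ u v uv e →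
           proper _ _ (encode-edge (copy i u) (copy i v) (copy-edge i u v uv))
             (punchOut-injective (i≢c u) (i≢c v) e))

    choice : Fin k → Fin m
    choice i = proj₁ (hit i)

    i : Fin k
    -- The clash occurs in the copy indexed by the colour of the apex itself.
    i = c (encode (apex (funToFin choice)))

-- Iteration and conclusion.

point : PathSystem (Fin 1)
point = record
  { Path        = λ _ _ a → a ≡ zero
  ; Path?       = λ _ _ a → a ≟ zero
  ; Path-refl   = refl
  ; Path-trans  = λ where refl refl → refl
  ; Path-unique = λ where refl refl → refl
  }

uncolourable : ∀ n → ∃[ m ] ∃[ D ] ¬ Colourable (graph {m} D) n
uncolourable zero    = 1 , point , λ (c , _) → Fin.¬Fin0 (c zero)
uncolourable (suc n) =
  let m , D , ¬col = uncolourable n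
  -- One copy for each of the `suc n` colours to be defeated.
  in _ , zykov (suc n) D , zykov-uncolourable (suc n) D refl ¬col

colourable-mono : ∀ G {k l} → k ≤ l → Colourable G k → Colourable G l
colourable-mono G k≤l (c , proper) =
  (λ x → inject≤ (c x) k≤l) , λ x y xy e → proper x y xy (inject≤-injective _ _ _ _ e)

uncolourable⇒χ≥ : ∀ G {n} → ¬ Colourable G n → χ G ≥ n
-- The argument yields `n < χ G`, which is then weakened.
uncolourable⇒χ≥ G ¬col = ℕ.<⇒≤ (≰⇒> λ χ≤n →
  ¬col (colourable-mono G χ≤n (proj₁ (proj₂ (chromatic G)))))

theorem1p3 : ∀ (n : ℕ) → ∃[ G ] (χ G ≥ n × ω G ≤ 3 ×
    (∀ (S : Subset (order G)) → ω (G [ S ]) ≤ 2 → χ (G [ S ]) ≤ 4))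
theorem1p3 n =
  let m , D , ¬col = uncolourable n
  in graph D , uncolourable⇒χ≥ (graph D) ¬col , ω-graph≤3 D , χ-triangleFree≤4 D
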